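{- Let $n$ be a positive integer and let $A=[a_{i,j}]_{1\le i,j\le n}$ be a symmetric matrix over a commutative ring, with $a_{i,j}=0$ whenever $i+j\in\{2q:\ q=2,3,\ldots\}$. (i) If $n$ is even, then $$\mathrm{per}(A)=\left(\mathrm{per}[a_{2i,2j-1}]_{1\le i,j\le n/2}\right)^2$$ and $$(-1)^{n/2}\det(A)=\left(\det[a_{2i,2j-1}]_{1\le i,j\le n/2}\right)^2.$$ (ii) If $n>1$ and $n$ is odd, then $$\mathrm{per}(A)=a_{1,1}\left(\mathrm{per}[a_{2i,2j+1}]_{1\le i,j\le (n-1)/2}\right)^2$$ and $$(-1)^{(n-1)/2}\det(A)=a_{1,1}\left(\det[a_{2i,2j+1}]_{1\le i,j\le (n-1)/2}\right)^2.$$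
   Context: For an $n\times n$ matrix $A=[a_{i,j}]_{1\le i,j\le n}$ over a commutative ring, $\det(A)=\sum_{\sigma\in S_n}\mathrm{sign}(\sigma)\prod_{i=1}^n a_{i,\sigma(i)}$ is the determinant and $\mathrm{per}(A)=\sum_{\sigma\in S_n}\prod_{i=1}^n a_{i,\sigma(i)}$ is the permanent, where $S_n$ is the symmetric group on $\{1,\ldots,n\}$. -}

module Defs where

open import Algebra.Bundles using (CommutativeRing)
open import Data.Bool.Base using (if_then_else_)
open import Data.Fin.Base as Fin using (Fin; zero; suc; toℕ; fromℕ<; punchIn)
open import Data.Fin.Properties as Fin
  using (toℕ<n; toℕ-fromℕ<; punchIn-injective)
open import Data.Fin.Permutation as Perm
  using (Permutation′; _⟨$⟩ʳ_; insert; remove; insert-punchIn; insert-remove)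
open import Data.List.Base using (List; []; _∷_; [_]; map; foldr; allFin; cartesianProductWith)
open import Data.List.Relation.Unary.Any as Any using (Any; here)
import Data.List.Relation.Unary.Any.Properties as Any
open import Data.List.Relation.Unary.All as All using (All; []; _∷_)
import Data.List.Relation.Unary.All.Properties as All
open import Data.List.Relation.Unary.AllPairs as AllPairs using (AllPairs; []; _∷_)
import Data.List.Relation.Unary.AllPairs.Properties as AllPairs
open import Data.List.Membership.Propositional.Properties using (∈-allFin)
open import Data.List.Relation.Unary.Unique.Propositional using (Unique)
open import Data.List.Relation.Unary.Unique.Propositional.Properties using (allFin⁺)
open import Data.Nat.Base using (ℕ; zero; suc; _+_; _*_; _∸_; _≤_; _<_; _/_; z≤n; s≤s)
open import Data.Nat.Properties as ℕ
  using (≤-trans; ≤-reflexive; m∸n≤m; *-monoʳ-≤; *-comm; +-comm)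
open import Data.Nat.DivMod using (m/n*n≤m)
open import Relation.Binary.PropositionalEquality
  using (_≡_; _≢_; refl; sym; trans; cong; cong₂; subst)
open import Relation.Nullary using (¬_; does)
open import Relation.Nullary.Decidable using (_×-dec_)

import Algebra.Properties.CommutativeMonoid.Sum as Sum
import Algebra.Properties.Semiring.Exp as Exp

------------------------------------------------------------------------
-- One-based positions in Fin n

pos : ∀ {n} → Fin n → ℕ
pos i = suc (toℕ i)

at : ∀ {n} (k : ℕ) → .(1 ≤ k) → .(k ≤ n) → Fin n
at (suc k) _ k<n = fromℕ< k<n

pos-at : ∀ {n} k .(1≤k : 1 ≤ k) .(k≤n : k ≤ n) → pos (at k 1≤k k≤n) ≡ k
pos-at (suc k) _ k<n = cong suc (toℕ-fromℕ< k<n)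

private
  double-pos≤ : ∀ {h} (i : Fin h) → 2 * pos i ≤ 2 * h
  double-pos≤ i = *-monoʳ-≤ 2 (toℕ<n i)

  1≤2pos-1 : ∀ {h} (i : Fin h) → 1 ≤ 2 * pos i ∸ 1
  1≤2pos-1 i = ≤-trans (s≤s z≤n) (ℕ.m≤n+m _ (toℕ i))

at-2i : ∀ {h n} → .(2 * h ≤ n) → Fin h → Fin n
at-2i 2h≤n i = at (2 * pos i) (s≤s z≤n) (≤-trans (double-pos≤ i) 2h≤n)

at-2i-1 : ∀ {h n} → .(2 * h ≤ n) → Fin h → Fin n
at-2i-1 2h≤n i = at (2 * pos i ∸ 1) (1≤2pos-1 i)
  (≤-trans (m∸n≤m (2 * pos i) 1) (≤-trans (double-pos≤ i) 2h≤n))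

at-2i+1 : ∀ {h n} → .(2 * h < n) → Fin h → Fin n
at-2i+1 2h<n i = at (2 * pos i + 1) (s≤s z≤n)
  (≤-trans (≤-reflexive (+-comm (2 * pos i) 1)) (≤-trans (s≤s (double-pos≤ i)) 2h<n))

2*[n/2]≤n : ∀ n → 2 * (n / 2) ≤ n
2*[n/2]≤n n = ≤-trans (≤-reflexive (*-comm 2 (n / 2))) (m/n*n≤m n 2)

2*[[n∸1]/2]<n : ∀ {n} → 1 ≤ n → 2 * ((n ∸ 1) / 2) < n
2*[[n∸1]/2]<n {suc n} _ = s≤s (2*[n/2]≤n n)

------------------------------------------------------------------------
-- The symmetric group, enumerated

-- insert zero j π sends zero to j and otherwise acts as π, skipping j.
permutations : ∀ n → List (Permutation′ n)
permutations zero    = [ Perm.id ]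
permutations (suc n) = cartesianProductWith (insert zero) (allFin (suc n)) (permutations n)

-- Every permutation occurs in the list exactly once (permutations being
-- compared pointwise), so summing over the list is summing over Sₙ.
private
  insert-cong : ∀ {n} {j k : Fin (suc n)} {π ρ : Permutation′ n} →
                j ≡ k → π Perm.≈ ρ → insert zero j π Perm.≈ insert zero k ρ
  insert-cong         j≡k π≈ρ zero    = j≡k
  insert-cong {j = j} refl π≈ρ (suc i) = cong (punchIn j) (π≈ρ i)

  insert-injective : ∀ {n} (j : Fin (suc n)) (π ρ : Permutation′ n) →
                     insert zero j π Perm.≈ insert zero j ρ → π Perm.≈ ρ
  insert-injective j π ρ eq i = punchIn-injective j _ _ (eq (suc i))

permutations-complete : ∀ {n} (σ : Permutation′ n) → Any (σ Perm.≈_) (permutations n)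
permutations-complete {zero}  σ = here λ ()
permutations-complete {suc n} σ =
  Any.cartesianProductWith⁺ (insert zero)
    (λ j≡ π≈ i → trans (sym (insert-remove zero σ i)) (insert-cong j≡ π≈ i))
    (∈-allFin (σ ⟨$⟩ʳ zero))
    (permutations-complete (remove zero σ))

permutations-unique : ∀ n → AllPairs (λ σ τ → ¬ (σ Perm.≈ τ)) (permutations n)
permutations-unique zero    = [] ∷ []
permutations-unique (suc n) = go (allFin⁺ (suc n))
  where
  go : ∀ {js} → Unique js →
       AllPairs (λ σ τ → ¬ (σ Perm.≈ τ)) (cartesianProductWith (insert zero) js (permutations n))
  go []                           = []
  go {js = j ∷ js} (j∉js ∷ js!) = AllPairs.++⁺
    (AllPairs.map⁺ (AllPairs.map (λ {π} {ρ} π≉ρ eq → π≉ρ (insert-injective j π ρ eq))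
                                 (permutations-unique n)))
    (go js!)
    (All.map⁺ (All.universal (λ _ → differ j∉js) (permutations n)))
    where
    differ : ∀ {π ks} → All (j ≢_) ks →
             All (λ τ → ¬ (insert zero j π Perm.≈ τ))
                 (cartesianProductWith (insert zero) ks (permutations n))
    differ []           = []
    differ (j≢k ∷ j∉ks) = All.++⁺
      (All.map⁺ (All.universal (λ _ eq → j≢k (eq zero)) (permutations n)))
      (differ j∉ks)

-- The number of pairs i < j with σ j < σ i.
inversions : ∀ {n} → Permutation′ n → ℕ
inversions {n} σ = ∑[ i < n ] ∑[ j < n ]
  (if does ((i Fin.<? j) ×-dec ((σ ⟨$⟩ʳ j) Fin.<? (σ ⟨$⟩ʳ i))) then 1 else 0)
  where open Sum ℕ.+-0-commutativeMonoid using (sum-syntax)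

------------------------------------------------------------------------
-- Matrices over a commutative ring

module Matrices {c ℓ} (R : CommutativeRing c ℓ) where
  open CommutativeRing R using (Carrier; _≈_; 0#; 1#; -_; semiring; *-commutativeMonoid)
    renaming (_+_ to _+ᴿ_; _*_ to _*ᴿ_)
  open Exp semiring public using (_^_)
  open Sum *-commutativeMonoid public using () renaming (sum to ∏)

  Matrix : ℕ → Set c
  Matrix n = Fin n → Fin n → Carrier

  Symmetric : ∀ {n} → Matrix n → Set ℓ
  Symmetric a = ∀ i j → a i j ≈ a j i

  ∑Sym : ∀ n → (Permutation′ n → Carrier) → Carrier
  ∑Sym n f = foldr _+ᴿ_ 0# (map f (permutations n))

  sign : ∀ {n} → Permutation′ n → Carrier
  sign σ = (- 1#) ^ inversions σ

  det : ∀ {n} → Matrix n → Carrier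
  det {n} a = ∑Sym n λ σ → sign σ *ᴿ ∏ (λ i → a i (σ ⟨$⟩ʳ i))

  per : ∀ {n} → Matrix n → Carrier
  per {n} a = ∑Sym n λ σ → ∏ (λ i → a i (σ ⟨$⟩ʳ i))

{-# OPTIONS --safe #-}
module Submission where

-- For ε with ε² = 1 put det[ε] a = Σ_σ ε^inv(σ) ∏ᵢ a i (σ i), so that the
-- permanent (ε = 1) and the determinant (ε = -1) are treated at once.
-- With rows coloured by parity and columns by the opposite parity, a
-- checkerboard matrix is block diagonal up to sorting rows and columns; sorting
-- costs the sign ε^(h²) = ε^h, and by symmetry the two blocks are transposes of
-- each other.  The one entry that may break the checkerboard pattern is the
-- corner a₁₁, and by linearity in the first row
--   det[ε] a = a₁₁ · det[ε] (a without row and column 1) + det[ε] (a with a₁₁ := 0).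
-- A checkerboard matrix of odd size has non-square blocks, hence vanishes, so
-- only the second summand survives for even n and only the first for odd n.

open import Defs
open import Algebra.Bundles using (CommutativeRing)
open import Data.Bool.Base using (if_then_else_; _∧_)
open import Data.Fin.Base as Fin using (Fin; zero; suc; toℕ; punchIn)
open import Data.Fin.Permutation using (Permutation′; _⟨$⟩ʳ_; insert)
import Data.Fin.Properties as Fin
open import Data.List.Base
  using (List; []; _∷_; _++_; map; foldr; tabulate; allFin; length; mapMaybe; cartesianProductWith)
open import Data.List.Properties using (length-tabulate)
open import Data.Nat.Base as ℕ using (ℕ; zero; suc; _∸_; _≤_; _<_; _/_; z≤n; s≤s)
open import Data.Nat.Divisibility using (_∣_; _∤_; divides; _∣0; ∣m∣n⇒∣m+n; ∣-refl)
open import Data.Nat.DivMod using (m/n*n≡m)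
import Data.Nat.Properties as ℕ
open import Data.Nat.Properties using (≤-refl; <⇒≤)
open import Data.Product.Base using (∃; _×_; _,_)
open import Data.Sum using (_⊎_; inj₁; inj₂; [_,_]; isInj₁; isInj₂)
open import Function.Base using (_∘_; flip; id)
open import Relation.Binary.PropositionalEquality as ≡ using (_≡_; _≢_)
open import Relation.Nullary using (does; contradiction; yes; no)
import Algebra.Properties.CommutativeMonoid.Sum as Sum
import Algebra.Properties.Ring as RingProperties

-- Inversions of an inserted permutation

module ∑ℕ = Sum ℕ.+-0-commutativeMonoid

does-punchIn-< : ∀ {n} (i : Fin (suc n)) j k →
                 does (punchIn i j Fin.<? punchIn i k) ≡ does (j Fin.<? k)
does-punchIn-< zero    j       k       = ≡.refl
does-punchIn-< (suc i) zero    zero    = ≡.refl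
does-punchIn-< (suc i) zero    (suc k) = ≡.refl
does-punchIn-< (suc i) (suc j) zero    = ≡.refl
does-punchIn-< (suc i) (suc j) (suc k) = does-punchIn-< i j k

count-punchIn-< : ∀ {n} (j : Fin (suc n)) →
  ∑ℕ.sum (λ k → if does (punchIn j k Fin.<? j) then 1 else 0) ≡ toℕ j
count-punchIn-< {n}     zero    = ∑ℕ.sum-replicate-zero n
count-punchIn-< {suc n} (suc j) = ≡.cong suc (count-punchIn-< j)

-- The new pairs are those containing position `zero`; such a pair is inverted when its other value
-- lies below `j`, which happens `toℕ j` times. All other pairs keep their order because `punchIn j`
-- is monotone.
inversions-insert : ∀ {n} (j : Fin (suc n)) (π : Permutation′ n) →
                    inversions (insert zero j π) ≡ toℕ j ℕ.+ inversions π
inversions-insert j π = ≡.cong₂ ℕ._+_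
  -- Reindexing by `π` turns a count over positions into one over values.
  (≡.trans (≡.sym (∑ℕ.sum-permute (λ k → if does (punchIn j k Fin.<? j) then 1 else 0) π)) (count-punchIn-< j))
  (∑ℕ.sum-cong-≗ λ i → ∑ℕ.sum-cong-≗ λ k →
    ≡.cong (λ b → if does (i Fin.<? k) ∧ b then 1 else 0) (does-punchIn-< j (π ⟨$⟩ʳ k) (π ⟨$⟩ʳ i)))

-- Indices of given parity

-- Parity is that of the zero-based value, so `even` runs through the odd one-based positions and
-- `odd` through the even ones.
even odd : ∀ {h} → Fin h → Fin (h ℕ.* 2)
even zero    = zero
even (suc i) = suc (suc (even i))
odd zero     = suc zero
odd (suc i)  = suc (suc (odd i))

-- In a range of odd size the even values are zero and the successors of `odd` values; the odd
-- values are those of `suc ∘ even`.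
even⁺ : ∀ {h} → Fin (suc h) → Fin (suc (h ℕ.* 2))
even⁺ zero    = zero
even⁺ (suc i) = suc (odd i)

toℕ-even : ∀ {h} (i : Fin h) → toℕ (even i) ≡ toℕ i ℕ.* 2
toℕ-even zero    = ≡.refl
toℕ-even (suc i) = ≡.cong (2 ℕ.+_) (toℕ-even i)

toℕ-odd : ∀ {h} (i : Fin h) → toℕ (odd i) ≡ suc (toℕ i ℕ.* 2)
toℕ-odd zero    = ≡.refl
toℕ-odd (suc i) = ≡.cong (2 ℕ.+_) (toℕ-odd i)

toℕ-even⁺ : ∀ {h} (i : Fin (suc h)) → toℕ (even⁺ i) ≡ toℕ i ℕ.* 2
toℕ-even⁺ zero    = ≡.refl
toℕ-even⁺ (suc i) = ≡.cong suc (toℕ-odd i)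

pos-injective : ∀ {n} {i j : Fin n} → pos i ≡ pos j → i ≡ j
pos-injective = Fin.toℕ-injective ∘ ℕ.suc-injective

at-2i≡odd : ∀ {h} .(2h≤n : 2 ℕ.* h ≤ h ℕ.* 2) (i : Fin h) → at-2i 2h≤n i ≡ odd i
at-2i≡odd {h} 2h≤n i = pos-injective (≡.trans (pos-at {h ℕ.* 2} (2 ℕ.* pos i) (s≤s z≤n) _)
  (≡.trans (ℕ.*-comm 2 (pos i)) (≡.cong suc (≡.sym (toℕ-odd {h} i)))))

at-2i-1≡even : ∀ {h} .(2h≤n : 2 ℕ.* h ≤ h ℕ.* 2) (i : Fin h) → at-2i-1 2h≤n i ≡ even i
at-2i-1≡even {h} 2h≤n i = pos-injective (≡.trans (pos-at {h ℕ.* 2} (2 ℕ.* pos i ℕ.∸ 1) _ _)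
  (≡.trans (≡.cong ℕ.pred (ℕ.*-comm 2 (pos i))) (≡.cong suc (≡.sym (toℕ-even {h} i)))))

at-2i≡suc-even : ∀ {h} .(2h≤n : 2 ℕ.* h ≤ suc (h ℕ.* 2)) (i : Fin h) → at-2i 2h≤n i ≡ suc (even i)
at-2i≡suc-even {h} 2h≤n i = pos-injective (≡.trans (pos-at {suc (h ℕ.* 2)} (2 ℕ.* pos i) (s≤s z≤n) _)
  (≡.trans (ℕ.*-comm 2 (pos i)) (≡.cong (2 ℕ.+_) (≡.sym (toℕ-even {h} i)))))

at-2i+1≡suc-odd : ∀ {h} .(2h<n : 2 ℕ.* h ℕ.< suc (h ℕ.* 2)) (i : Fin h) → at-2i+1 2h<n i ≡ suc (odd i)
at-2i+1≡suc-odd {h} 2h<n i = pos-injective (≡.trans (pos-at {suc (h ℕ.* 2)} (2 ℕ.* pos i ℕ.+ 1) (s≤s z≤n) _)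
  (≡.trans (ℕ.+-comm (2 ℕ.* pos i) 1) (≡.cong suc (≡.trans (ℕ.*-comm 2 (pos i)) (≡.cong suc (≡.sym (toℕ-odd {h} i)))))))

-- Interleaved lists and crossings of two-coloured lists

interleave : ∀ {a} {A : Set a} {h} → (Fin h → A) → (Fin h → A) → List A
interleave {h = zero}  f g = []
interleave {h = suc h} f g = f zero ∷ g zero ∷ interleave (f ∘ suc) (g ∘ suc)

tabulate-interleave : ∀ {a} {A : Set a} h (k : Fin (h ℕ.* 2) → A) →
                      tabulate k ≡ interleave {h = h} (k ∘ even) (k ∘ odd)
tabulate-interleave zero    k = ≡.refl
tabulate-interleave (suc h) k =
  ≡.cong (λ w → k zero ∷ k (suc zero) ∷ w) (tabulate-interleave h (λ i → k (suc (suc i))))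

map-interleave : ∀ {a b} {A : Set a} {B : Set b} (u : A → B) {h} (f g : Fin h → A) →
                 map u (interleave f g) ≡ interleave (u ∘ f) (u ∘ g)
map-interleave u {zero}  f g = ≡.refl
map-interleave u {suc h} f g =
  ≡.cong (λ w → u (f zero) ∷ u (g zero) ∷ w) (map-interleave u (f ∘ suc) (g ∘ suc))

module _ {X Y : Set} where
  lefts : List (X ⊎ Y) → List X
  lefts = mapMaybe isInj₁

  rights : List (X ⊎ Y) → List Y
  rights = mapMaybe isInj₂

  -- The number of adjacent swaps that sort the left entries before the right ones.
  crossings : List (X ⊎ Y) → ℕ
  crossings []           = 0
  crossings (inj₁ _ ∷ w) = crossings w
  crossings (inj₂ _ ∷ w) = length (lefts w) ℕ.+ crossings w

lefts-interleave₁₂ : ∀ {X Y : Set} {h} (f : Fin h → X) (g : Fin h → Y) →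
                     lefts (interleave (inj₁ ∘ f) (inj₂ ∘ g)) ≡ tabulate f
lefts-interleave₁₂ {h = zero}  f g = ≡.refl
lefts-interleave₁₂ {h = suc h} f g = ≡.cong (f zero ∷_) (lefts-interleave₁₂ (f ∘ suc) (g ∘ suc))

rights-interleave₁₂ : ∀ {X Y : Set} {h} (f : Fin h → X) (g : Fin h → Y) →
                      rights (interleave (inj₁ ∘ f) (inj₂ ∘ g)) ≡ tabulate g
rights-interleave₁₂ {h = zero}  f g = ≡.refl
rights-interleave₁₂ {h = suc h} f g = ≡.cong (g zero ∷_) (rights-interleave₁₂ (f ∘ suc) (g ∘ suc))

lefts-interleave₂₁ : ∀ {X Y : Set} {h} (f : Fin h → Y) (g : Fin h → X) →
                     lefts (interleave (inj₂ ∘ f) (inj₁ ∘ g)) ≡ tabulate g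
lefts-interleave₂₁ {h = zero}  f g = ≡.refl
lefts-interleave₂₁ {h = suc h} f g = ≡.cong (g zero ∷_) (lefts-interleave₂₁ (f ∘ suc) (g ∘ suc))

rights-interleave₂₁ : ∀ {X Y : Set} {h} (f : Fin h → Y) (g : Fin h → X) →
                      rights (interleave (inj₂ ∘ f) (inj₁ ∘ g)) ≡ tabulate f
rights-interleave₂₁ {h = zero}  f g = ≡.refl
rights-interleave₂₁ {h = suc h} f g = ≡.cong (f zero ∷_) (rights-interleave₂₁ (f ∘ suc) (g ∘ suc))

-- The leading right entry precedes the `h` left entries of the tail. Iterated, this gives h(h-1)/2
-- crossings for h pairs.
crossings-interleave₁₂ : ∀ {X Y : Set} {h} (f : Fin (suc h) → X) (g : Fin (suc h) → Y) →
  crossings (interleave (inj₁ ∘ f) (inj₂ ∘ g)) ≡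
  h ℕ.+ crossings (interleave (inj₁ ∘ f ∘ suc) (inj₂ ∘ g ∘ suc))
crossings-interleave₁₂ f g = ≡.cong (ℕ._+ crossings (interleave (inj₁ ∘ f ∘ suc) (inj₂ ∘ g ∘ suc)))
  (≡.trans (≡.cong length (lefts-interleave₁₂ (f ∘ suc) (g ∘ suc))) (length-tabulate (f ∘ suc)))

-- Here the leading right entry also precedes the left entry of its own pair, so h pairs have
-- h(h+1)/2 crossings.
crossings-interleave₂₁ : ∀ {X Y : Set} {h} (f : Fin (suc h) → Y) (g : Fin (suc h) → X) →
  crossings (interleave (inj₂ ∘ f) (inj₁ ∘ g)) ≡
  suc h ℕ.+ crossings (interleave (inj₂ ∘ f ∘ suc) (inj₁ ∘ g ∘ suc))
crossings-interleave₂₁ f g = ≡.cong (λ k → suc k ℕ.+ crossings (interleave (inj₂ ∘ f ∘ suc) (inj₁ ∘ g ∘ suc)))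
  (≡.trans (≡.cong length (lefts-interleave₂₁ (f ∘ suc) (g ∘ suc))) (length-tabulate (g ∘ suc)))

even∣ : ∀ {m n} k l → m ≡ k ℕ.* 2 → n ≡ l ℕ.* 2 → 2 ∣ m ℕ.+ n
even∣ k l m≡ n≡ = ∣m∣n⇒∣m+n (divides k m≡) (divides l n≡)

2∣suc+suc : ∀ {m n} → 2 ∣ m ℕ.+ n → 2 ∣ suc m ℕ.+ suc n
2∣suc+suc {m} {n} 2∣m+n = ≡.subst (2 ∣_) (≡.cong suc (≡.sym (ℕ.+-suc m n))) (∣m∣n⇒∣m+n ∣-refl 2∣m+n)

2∣pred : ∀ {n} → 2 ∤ suc n → 2 ∣ n
2∣pred {zero}        2∤1 = 2 ∣0
2∣pred {suc zero}    2∤2 = contradiction ∣-refl 2∤2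
2∣pred {suc (suc n)} 2∤  = ∣m∣n⇒∣m+n ∣-refl (2∣pred (2∤ ∘ ∣m∣n⇒∣m+n ∣-refl))

-- Laplace expansion of `det[ε]`

module Determinants {c ℓ} (R : CommutativeRing c ℓ) (ε : CommutativeRing.Carrier R) where
  open CommutativeRing R hiding (zero)
  open Matrices R
  open import Algebra.Properties.Semiring.Sum semiring using (sum; sum-cong-≋; *-distribˡ-sum)
  open import Algebra.Properties.Semiring.Exp semiring using (^-homo-*; ^-congʳ)
  open import Algebra.Properties.CommutativeSemigroup *-commutativeSemigroup
    using (x∙yz≈y∙xz; interchange)
  import Algebra.Properties.CommutativeSemigroup +-commutativeSemigroup as +ₛ
  open import Relation.Binary.Reasoning.Setoid setoid

  ∑List : ∀ {a} {A : Set a} → (A → Carrier) → List A → Carrier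
  ∑List f xs = foldr _+_ 0# (map f xs)

  ∑List-cong : ∀ {a} {A : Set a} {f g : A → Carrier} →
               (∀ x → f x ≈ g x) → ∀ xs → ∑List f xs ≈ ∑List g xs
  ∑List-cong f≈g []       = refl
  ∑List-cong f≈g (x ∷ xs) = +-cong (f≈g x) (∑List-cong f≈g xs)

  *-distribˡ-∑List : ∀ {a} {A : Set a} x (f : A → Carrier) ys →
                     ∑List (λ y → x * f y) ys ≈ x * ∑List f ys
  *-distribˡ-∑List x f []       = sym (zeroʳ x)
  *-distribˡ-∑List x f (y ∷ ys) = trans (+-congˡ (*-distribˡ-∑List x f ys)) (sym (distribˡ x _ _))

  ∑List-map-++ : ∀ {a b} {A : Set a} {B : Set b} (f : B → Carrier) (h : A → B) xs ys →
                 ∑List f (map h xs ++ ys) ≈ ∑List (f ∘ h) xs + ∑List f ys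
  ∑List-map-++ f h []       ys = sym (+-identityˡ _)
  ∑List-map-++ f h (x ∷ xs) ys = trans (+-congˡ (∑List-map-++ f h xs ys)) (sym (+-assoc _ _ _))

  ∑List-cartesianProductWith :
    ∀ {a b d n} {A : Set a} {B : Set b} {D : Set d}
    (f : D → Carrier) (_⊗_ : A → B → D) (k : Fin n → A) ys →
    ∑List f (cartesianProductWith _⊗_ (tabulate k) ys) ≈ sum (λ i → ∑List (λ y → f (k i ⊗ y)) ys)
  ∑List-cartesianProductWith {n = zero}  f _⊗_ k ys = refl
  ∑List-cartesianProductWith {n = suc n} f _⊗_ k ys =
    trans (∑List-map-++ f (k zero ⊗_) ys _)
          (+-congˡ (∑List-cartesianProductWith f _⊗_ (k ∘ suc) ys))

  det[ε] : ∀ {n} → Matrix n → Carrier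
  det[ε] {n} a = ∑Sym n λ σ → ε ^ inversions σ * ∏ λ i → a i (σ ⟨$⟩ʳ i)

  -- `permutations` enumerates by the image `j` of `zero`, and inserting `j` adds `toℕ j`
  -- inversions, whence the power of `ε`.
  laplace : ∀ {n} (a : Matrix (suc n)) →
    det[ε] a ≈ sum λ j → ε ^ toℕ j * (a zero j * det[ε] λ i k → a (suc i) (punchIn j k))
  laplace {n} a = trans
    (∑List-cartesianProductWith term (insert zero) id (permutations n))
    (sum-cong-≋ λ j → begin
      ∑Sym n (term ∘ insert zero j)
        ≈⟨ ∑List-cong (λ π → let P = ∏ λ i → a (suc i) (punchIn j (π ⟨$⟩ʳ i)) in begin
             ε ^ inversions (insert zero j π) * (a zero j * P)
               ≈⟨ *-congʳ (trans (^-congʳ ε (inversions-insert j π)) (^-homo-* ε (toℕ j) (inversions π))) ⟩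
             (ε ^ toℕ j * ε ^ inversions π) * (a zero j * P)
               ≈⟨ interchange _ _ _ _ ⟩
             (ε ^ toℕ j * a zero j) * (ε ^ inversions π * P) ∎)
           (permutations n) ⟩
      ∑Sym n (λ π → (ε ^ toℕ j * a zero j) * (ε ^ inversions π * ∏ λ i → a (suc i) (punchIn j (π ⟨$⟩ʳ i))))
        ≈⟨ *-distribˡ-∑List _ _ (permutations n) ⟩
      (ε ^ toℕ j * a zero j) * det[ε] (λ i k → a (suc i) (punchIn j k))
        ≈⟨ *-assoc _ _ _ ⟩
      ε ^ toℕ j * (a zero j * det[ε] λ i k → a (suc i) (punchIn j k)) ∎)
    where
    term : Permutation′ (suc n) → Carrier
    term σ = ε ^ inversions σ * ∏ λ i → a i (σ ⟨$⟩ʳ i)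

  det[ε]-cong : ∀ {n} {a b : Matrix n} → (∀ i j → a i j ≈ b i j) → det[ε] a ≈ det[ε] b
  det[ε]-cong {zero}          a≈b = refl
  det[ε]-cong {suc n} {a} {b} a≈b = begin
    det[ε] a ≈⟨ laplace a ⟩
    _        ≈⟨ sum-cong-≋ (λ j → *-congˡ {ε ^ toℕ j} (*-cong (a≈b zero j)
                  (det[ε]-cong λ i k → a≈b (suc i) (punchIn j k)))) ⟩
    _        ≈⟨ laplace b ⟨
    det[ε] b ∎

  clearCorner : ∀ {n} → Matrix (suc n) → Matrix (suc n)
  clearCorner a zero    zero    = 0#
  clearCorner a zero    (suc j) = a zero (suc j)
  clearCorner a (suc i) j       = a (suc i) j

  -- The first-row expansions of `a` and `clearCorner a` have the same minors and differ only in the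
  -- term of column `zero`.
  det[ε]-corner : ∀ {n} (a : Matrix (suc n)) →
    det[ε] a ≈ a zero zero * det[ε] (λ i j → a (suc i) (suc j)) + det[ε] (clearCorner a)
  det[ε]-corner a = begin
    det[ε] a                   ≈⟨ laplace a ⟩
    1# * x + rest              ≈⟨ +-congʳ (*-identityˡ x) ⟩
    x + rest                   ≈⟨ +-congˡ (trans (+-congʳ (trans (*-congˡ (zeroˡ _)) (zeroʳ 1#))) (+-identityˡ rest)) ⟨
    x + (1# * (0# * _) + rest) ≈⟨ +-congˡ (laplace (clearCorner a)) ⟨
    x + det[ε] (clearCorner a) ∎
    where
    x = a zero zero * det[ε] (λ i j → a (suc i) (suc j))
    rest = sum λ j → ε ^ suc (toℕ j) * (a zero (suc j) * det[ε] λ i k → a (suc i) (punchIn (suc j) k))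

  -- Expansions and minors indexed by lists

  module _ {J : Set} where
    -- expand g [c₀,…,cₘ] = Σᵢ εⁱ g cᵢ [c₀,…,cᵢ₋₁,cᵢ₊₁,…,cₘ]
    expand : (J → List J → Carrier) → List J → Carrier
    expand g []       = 0#
    expand g (c ∷ cs) = g c cs + ε * expand (λ d ds → g d (c ∷ ds)) cs

    -- Only lists `ds` one shorter than `cs` occur in the expansion; this length information drives
    -- the inductions on size below.
    expand-cong : ∀ {g h : J → List J → Carrier} cs →
                  (∀ d ds → suc (length ds) ≡ length cs → g d ds ≈ h d ds) →
                  expand g cs ≈ expand h cs
    expand-cong []       g≈h = refl
    expand-cong (c ∷ cs) g≈h = +-cong (g≈h c cs ≡.refl)
      (*-congˡ (expand-cong cs λ d ds eq → g≈h d (c ∷ ds) (≡.cong suc eq)))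

    expand-+ : ∀ (g h : J → List J → Carrier) cs →
               expand (λ d ds → g d ds + h d ds) cs ≈ expand g cs + expand h cs
    expand-+ g h []       = sym (+-identityˡ 0#)
    expand-+ g h (c ∷ cs) = trans
      (+-congˡ (trans (*-congˡ (expand-+ _ _ cs)) (distribˡ ε _ _)))
      (+ₛ.interchange _ _ _ _)

    expand-* : ∀ x (g : J → List J → Carrier) cs →
               expand (λ d ds → x * g d ds) cs ≈ x * expand g cs
    expand-* x g []       = sym (zeroʳ x)
    expand-* x g (c ∷ cs) = trans
      (+-congˡ (trans (*-congˡ (expand-* x _ cs)) (x∙yz≈y∙xz ε x _)))
      (sym (distribˡ x _ _))

    expand-0 : ∀ cs → expand (λ _ _ → 0#) cs ≈ 0#
    expand-0 []       = refl
    expand-0 (c ∷ cs) = trans (+-identityˡ _) (trans (*-congˡ (expand-0 cs)) (zeroʳ ε))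

    expand-zero : ∀ {g : J → List J → Carrier} cs →
                  (∀ d ds → suc (length ds) ≡ length cs → g d ds ≈ 0#) → expand g cs ≈ 0#
    expand-zero cs g≈0 = trans (expand-cong cs g≈0) (expand-0 cs)

    -- Deleting entry `j` of `tabulate k` amounts to composing `k` with `punchIn j`, so `expand`
    -- matches the sum in `laplace`.
    expand-tabulate : ∀ {n} (g : J → List J → Carrier) (k : Fin (suc n) → J) →
      expand g (tabulate k) ≈ sum λ j → ε ^ toℕ j * g (k j) (tabulate (k ∘ punchIn j))
    expand-tabulate {zero}  g k = +-cong (sym (*-identityˡ _)) (zeroʳ ε)
    expand-tabulate {suc n} g k = +-cong (sym (*-identityˡ _)) (begin
      ε * expand (λ d ds → g d (k zero ∷ ds)) (tabulate (k ∘ suc))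
        ≈⟨ *-congˡ (expand-tabulate (λ d ds → g d (k zero ∷ ds)) (k ∘ suc)) ⟩
      ε * sum (λ j → ε ^ toℕ j * t j)
        ≈⟨ *-distribˡ-sum ε (λ j → ε ^ toℕ j * t j) ⟩
      sum (λ j → ε * (ε ^ toℕ j * t j))
        ≈⟨ sum-cong-≋ (λ j → sym (*-assoc ε (ε ^ toℕ j) (t j))) ⟩
      sum (λ j → ε ^ suc (toℕ j) * t j) ∎)
      where
      t : Fin (suc n) → Carrier
      t j = g (k (suc j)) (k zero ∷ tabulate (k ∘ suc ∘ punchIn j))

  expand-swap : ∀ {I J : Set} (F : I → List I → J → List J → Carrier) rs cs →
    expand (λ d ds → expand (λ s ss → F s ss d ds) rs) cs ≈
    expand (λ s ss → expand (λ d ds → F s ss d ds) cs) rs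
  expand-swap F []       cs = expand-0 cs
  expand-swap F (r ∷ rs) cs = trans
    (expand-+ (λ d ds → F r rs d ds) _ cs)
    (+-congˡ (trans (expand-* ε _ cs) (*-congˡ (expand-swap (λ s ss → F s (r ∷ ss)) rs cs))))

  -- Zero unless there are as many rows as columns; with this convention the
  -- block formula below needs no hypothesis on the sizes of the blocks.
  minor : ∀ {I J : Set} → (I → J → Carrier) → List I → List J → Carrier
  minor M []       []      = 1#
  minor M []       (_ ∷ _) = 0#
  minor M (r ∷ rs) cs      = expand (λ c cs′ → M r c * minor M rs cs′) cs

  -- Each expansion step removes one row and one column, so a difference in length persists until
  -- one list is exhausted.
  minor-nonsquare : ∀ {I J : Set} (M : I → J → Carrier) rs cs →
                    length rs ≢ length cs → minor M rs cs ≈ 0#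
  minor-nonsquare M []       []       ≢ = contradiction ≡.refl ≢
  minor-nonsquare M []       (_ ∷ _)  ≢ = refl
  minor-nonsquare M (r ∷ rs) cs       ≢ = expand-zero cs λ d ds eq →
    trans (*-congˡ (minor-nonsquare M rs ds λ e → ≢ (≡.trans (≡.cong suc e) eq))) (zeroʳ _)

  -- Expansion along the first row agrees with expansion along the first column. The corner terms
  -- agree by induction; the others become a double expansion along both, whose order is exchanged
  -- by `expand-swap`.
  minor-transpose : ∀ {I J : Set} (M : I → J → Carrier) rs cs →
                    minor M rs cs ≈ minor (flip M) cs rs
  minor-transpose M rs = go (length rs) rs ℕ.≤-refl
    where
    -- Induction on a bound for the number of rows: the hypothesis is also applied to `ss` and
    -- `r ∷ ss`, where `ss` is `rs` with one entry deleted.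
    go : ∀ n rs → length rs ≤ n → ∀ cs → minor M rs cs ≈ minor (flip M) cs rs
    go n       []       _         []       = refl
    go n       []       _         (c ∷ cs) = refl
    go n       (r ∷ rs) _         []       = refl
    go (suc n) (r ∷ rs) (s≤s ≤n) (c ∷ cs) = +-cong
      (*-congˡ (go n rs ≤n cs))
      (*-congˡ (begin
        expand (λ d ds → M r d * minor M rs (c ∷ ds)) cs
          ≈⟨ expand-cong cs (λ d ds _ → trans (*-congˡ (begin
               minor M rs (c ∷ ds)
                 ≈⟨ go n rs ≤n (c ∷ ds) ⟩
               expand (λ s ss → M s c * minor (flip M) ds ss) rs
                 ≈⟨ expand-cong rs (λ s ss eq → *-congˡ
                      (go n ss (ℕ.<⇒≤ (ℕ.≤-trans (ℕ.≤-reflexive eq) ≤n)) ds)) ⟨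
               expand (λ s ss → M s c * minor M ss ds) rs ∎))
               (sym (expand-* (M r d) _ rs))) ⟩
        expand (λ d ds → expand (λ s ss → M r d * (M s c * minor M ss ds)) rs) cs
          ≈⟨ expand-swap (λ s ss d ds → M r d * (M s c * minor M ss ds)) rs cs ⟩
        expand (λ s ss → expand (λ d ds → M r d * (M s c * minor M ss ds)) cs) rs
          ≈⟨ expand-cong rs (λ s ss eq → begin
               expand (λ d ds → M r d * (M s c * minor M ss ds)) cs
                 ≈⟨ expand-cong cs (λ d ds _ → x∙yz≈y∙xz _ _ _) ⟩
               expand (λ d ds → M s c * (M r d * minor M ss ds)) cs
                 ≈⟨ expand-* (M s c) _ cs ⟩
               M s c * minor M (r ∷ ss) cs
                 ≈⟨ *-congˡ (go n (r ∷ ss) (ℕ.≤-trans (ℕ.≤-reflexive eq) ≤n) cs) ⟩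
               M s c * minor (flip M) cs (r ∷ ss) ∎) ⟩
        expand (λ s ss → M s c * minor (flip M) cs (r ∷ ss)) rs ∎))

  minor-tabulate : ∀ {I J : Set} (M : I → J → Carrier) {n} (k : Fin n → I) (l : Fin n → J) →
                   minor M (tabulate k) (tabulate l) ≈ det[ε] λ i j → M (k i) (l j)
  minor-tabulate M {zero}  k l = sym (trans (+-identityʳ _) (*-identityˡ 1#))
  minor-tabulate M {suc n} k l = begin
    minor M (tabulate k) (tabulate l)
      ≈⟨ expand-tabulate (λ c cs → M (k zero) c * minor M (tabulate (k ∘ suc)) cs) l ⟩
    sum (λ j → ε ^ toℕ j * (M (k zero) (l j) * minor M (tabulate (k ∘ suc)) (tabulate (l ∘ punchIn j))))
      ≈⟨ sum-cong-≋ (λ j → *-congˡ {ε ^ toℕ j} (*-congˡ {M (k zero) (l j)} (minor-tabulate M (k ∘ suc) (l ∘ punchIn j)))) ⟩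
    _ ≈⟨ laplace (λ i j → M (k i) (l j)) ⟨
    det[ε] (λ i j → M (k i) (l j)) ∎

  -- Allows indices to be replaced by coloured ones, the colour recording the parity.
  minor-map : ∀ {I J I′ J′ : Set} (M : I → J → Carrier) (u : I′ → I) (v : J′ → J) rs cs →
              minor M (map u rs) (map v cs) ≈ minor (λ i j → M (u i) (v j)) rs cs
  minor-map M u v []       []       = refl
  minor-map M u v []       (_ ∷ _)  = refl
  minor-map M u v (r ∷ rs) cs       = trans (expand-map _ cs)
    (expand-cong cs λ d ds _ → *-congˡ (minor-map M u v rs ds))
    where
    expand-map : ∀ g cs → expand g (map v cs) ≈ expand (λ d ds → g (v d) (map v ds)) cs
    expand-map g []       = refl
    expand-map g (c ∷ cs) = +-congˡ (*-congˡ (expand-map _ cs))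

  det[ε]-transpose : ∀ {n} (a : Matrix n) → det[ε] (flip a) ≈ det[ε] a
  det[ε]-transpose {n} a = begin
    det[ε] (flip a)                     ≈⟨ minor-tabulate (flip a) id id ⟨
    minor (flip a) (allFin n) (allFin n) ≈⟨ minor-transpose a (allFin n) (allFin n) ⟨
    minor a (allFin n) (allFin n)       ≈⟨ minor-tabulate a id id ⟩
    det[ε] a                            ∎

-- Sorting signs and factorisation into blocks

module Signed {c ℓ} (R : CommutativeRing c ℓ) (ε : CommutativeRing.Carrier R)
  (ε²≈1 : CommutativeRing._≈_ R (CommutativeRing._*_ R ε ε) (CommutativeRing.1# R)) where
  open CommutativeRing R hiding (zero)
  open Matrices R
  open Determinants R ε
  open import Algebra.Properties.Semiring.Exp semiring using (^-homo-*; ^-congʳ; ^-congˡ)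
  open import Algebra.Properties.CommutativeSemigroup *-commutativeSemigroup
    using (x∙yz≈y∙xz; interchange)
  open import Algebra.Solver.CommutativeMonoid *-commutativeMonoid using (solve; _⊜_; _⊕_)
  open import Relation.Binary.Reasoning.Setoid setoid

  ε^n*ε^n≈1 : ∀ n → ε ^ n * ε ^ n ≈ 1#
  ε^n*ε^n≈1 zero    = *-identityˡ 1#
  ε^n*ε^n≈1 (suc n) = trans (interchange ε (ε ^ n) ε (ε ^ n))
    (trans (*-cong ε²≈1 (ε^n*ε^n≈1 n)) (*-identityˡ 1#))

  ε^[m+n]* : ∀ m n x → ε ^ (m ℕ.+ n) * x ≈ ε ^ n * (ε ^ m * x)
  ε^[m+n]* m n x = trans (*-congʳ (^-homo-* ε m n)) (trans (*-assoc _ _ x) (x∙yz≈y∙xz _ _ x))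

  ε^n-cancel : ∀ n x → ε ^ n * (ε ^ n * x) ≈ x
  ε^n-cancel n x = trans (sym (*-assoc _ _ x)) (trans (*-congʳ (ε^n*ε^n≈1 n)) (*-identityˡ x))

  module _ {X Y : Set} where
    -- If r right entries precede a left entry, deleting it removes r crossings, while its position
    -- exceeds its rank among the left entries by r. The two effects on the power of `ε` compensate.
    expand-lefts : ∀ (g : X ⊎ Y → List (X ⊎ Y) → Carrier) (h : X → List X → List Y → Carrier) →
      (∀ y w → g (inj₂ y) w ≈ 0#) →
      (∀ x w → g (inj₁ x) w ≈ ε ^ crossings w * h x (lefts w) (rights w)) →
      ∀ w → expand g w ≈ ε ^ crossings w * expand (λ x xs → h x xs (rights w)) (lefts w)
    expand-lefts g h g₂ g₁ []           = sym (zeroʳ 1#)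
    expand-lefts g h g₂ g₁ (inj₁ x ∷ w) = begin
      g (inj₁ x) w + ε * expand (λ d ds → g d (inj₁ x ∷ ds)) w
        ≈⟨ +-cong (g₁ x w) (*-congˡ (expand-lefts (λ d ds → g d (inj₁ x ∷ ds))
             (λ d ds → h d (x ∷ ds)) (λ y v → g₂ y _) (λ d v → g₁ d _) w)) ⟩
      q * h x (lefts w) (rights w) + ε * (q * E)
        ≈⟨ +-congˡ (x∙yz≈y∙xz ε q E) ⟩
      q * h x (lefts w) (rights w) + q * (ε * E)
        ≈⟨ distribˡ q _ _ ⟨
      q * (h x (lefts w) (rights w) + ε * E) ∎
      where
      q = ε ^ crossings w
      E = expand (λ d ds → h d (x ∷ ds) (rights w)) (lefts w)
    expand-lefts g h g₂ g₁ (inj₂ y ∷ w) = begin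
      g (inj₂ y) w + ε * expand (λ d ds → g d (inj₂ y ∷ ds)) w
        -- With `y` kept in front, its crossings with the remaining left entries `ds` are absorbed
        -- into `h` as `ε ^ length ds`.
        ≈⟨ +-cong (g₂ y w) (*-congˡ (expand-lefts (λ d ds → g d (inj₂ y ∷ ds))
             (λ d ds es → ε ^ length ds * h d ds (y ∷ es)) (λ z v → g₂ z _)
             (λ d v → trans (g₁ d _) (ε^[m+n]* (length (lefts v)) (crossings v) _)) w)) ⟩
      0# + ε * (q * expand (λ d ds → ε ^ length ds * k d ds) (lefts w))
        ≈⟨ trans (+-identityˡ _) (x∙yz≈y∙xz ε q _) ⟩
      q * (ε * expand (λ d ds → ε ^ length ds * k d ds) (lefts w))
        ≈⟨ *-congˡ (weighted (lefts w)) ⟩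
      q * (ε ^ length (lefts w) * expand k (lefts w))
        ≈⟨ ε^[m+n]* (length (lefts w)) (crossings w) _ ⟨
      ε ^ (length (lefts w) ℕ.+ crossings w) * expand k (lefts w) ∎
      where
      q = ε ^ crossings w
      k : X → List X → Carrier
      k d ds = h d ds (y ∷ rights w)
      -- The deleted list is one shorter than `xs`; the outer `ε` makes up for the missing entry.
      weighted : ∀ xs → ε * expand (λ d ds → ε ^ length ds * k d ds) xs ≈ ε ^ length xs * expand k xs
      weighted []       = trans (zeroʳ ε) (sym (zeroʳ 1#))
      weighted (x ∷ xs) = begin
        ε * expand (λ d ds → ε ^ length ds * k d ds) (x ∷ xs)
          ≈⟨ *-congˡ (expand-cong (x ∷ xs) λ d ds eq → *-congʳ {k d ds} (^-congʳ ε (ℕ.suc-injective eq))) ⟩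
        ε * expand (λ d ds → ε ^ length xs * k d ds) (x ∷ xs)
          ≈⟨ *-congˡ (expand-* (ε ^ length xs) k (x ∷ xs)) ⟩
        ε * (ε ^ length xs * expand k (x ∷ xs))
          ≈⟨ *-assoc ε _ _ ⟨
        ε ^ suc (length xs) * expand k (x ∷ xs) ∎

    -- Unlike a left entry, a right entry is sorted behind all left entries, hence
    -- the extra factor.
    expand-rights : ∀ (g : X ⊎ Y → List (X ⊎ Y) → Carrier) (h : Y → List X → List Y → Carrier) →
      (∀ x w → g (inj₁ x) w ≈ 0#) →
      (∀ y w → g (inj₂ y) w ≈ ε ^ crossings w * h y (lefts w) (rights w)) →
      ∀ w → expand g w ≈
            ε ^ crossings w * (ε ^ length (lefts w) * expand (λ y ys → h y (lefts w) ys) (rights w))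
    expand-rights g h g₁ g₂ []           = sym (trans (*-identityˡ _) (zeroʳ 1#))
    expand-rights g h g₁ g₂ (inj₁ x ∷ w) = begin
      g (inj₁ x) w + ε * expand (λ d ds → g d (inj₁ x ∷ ds)) w
        ≈⟨ +-cong (g₁ x w) (*-congˡ (expand-rights (λ d ds → g d (inj₁ x ∷ ds))
             (λ d xs ys → h d (x ∷ xs) ys) (λ z v → g₁ z _) (λ d v → g₂ d _) w)) ⟩
      0# + ε * (ε ^ crossings w * (ε ^ length (lefts w) * E))
        ≈⟨ trans (+-identityˡ _) (x∙yz≈y∙xz ε _ _) ⟩
      ε ^ crossings w * (ε * (ε ^ length (lefts w) * E))
        ≈⟨ *-congˡ (*-assoc ε _ _) ⟨
      ε ^ crossings w * (ε ^ suc (length (lefts w)) * E) ∎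
      where
      E = expand (λ y ys → h y (x ∷ lefts w) ys) (rights w)
    expand-rights g h g₁ g₂ (inj₂ y ∷ w) = begin
      g (inj₂ y) w + ε * expand (λ d ds → g d (inj₂ y ∷ ds)) w
        ≈⟨ +-cong (g₂ y w) (*-congˡ (expand-rights (λ d ds → g d (inj₂ y ∷ ds))
             (λ d xs ys → ε ^ length xs * h d xs (y ∷ ys)) (λ z v → g₁ z _)
             (λ d v → trans (g₂ d _) (ε^[m+n]* (length (lefts v)) (crossings v) _)) w)) ⟩
      q * h₀ + ε * (q * (p * expand (λ d ds → p * h d (lefts w) (y ∷ ds)) (rights w)))
        -- One `p` is the extra factor of the induction hypothesis, the other counts the crossings
        -- of `y`; they cancel since `ε` squares to one.
        ≈⟨ +-congˡ (*-congˡ (*-congˡ (trans (*-congˡ (expand-* p _ (rights w))) (ε^n-cancel (length (lefts w)) E)))) ⟩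
      q * h₀ + ε * (q * E)
        ≈⟨ trans (+-congˡ (x∙yz≈y∙xz ε q E)) (sym (distribˡ q h₀ (ε * E))) ⟩
      q * (h₀ + ε * E)
        -- Two copies of `p` are inserted: one joins `q` to give the crossings of `inj₂ y ∷ w`, the
        -- other is the required extra factor.
        ≈⟨ *-congˡ (ε^n-cancel (length (lefts w)) _) ⟨
      q * (p * (p * (h₀ + ε * E)))
        ≈⟨ solve 3 (λ p q z → q ⊕ (p ⊕ (p ⊕ z)) ⊜ (p ⊕ q) ⊕ (p ⊕ z)) refl p q (h₀ + ε * E) ⟩
      (p * q) * (p * (h₀ + ε * E))
        ≈⟨ *-congʳ (^-homo-* ε (length (lefts w)) (crossings w)) ⟨
      ε ^ (length (lefts w) ℕ.+ crossings w) * (p * (h₀ + ε * E)) ∎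
      where
      p = ε ^ length (lefts w)
      q = ε ^ crossings w
      h₀ = h y (lefts w) (rights w)
      E = expand (λ d ds → h d (lefts w) (y ∷ ds)) (rights w)

  -- A row meets only columns of its own colour, so induction on the rows applies `expand-lefts` or
  -- `expand-rights` to each.
  minor-blocks : ∀ {X Y X′ Y′ : Set} (M : X ⊎ Y → X′ ⊎ Y′ → Carrier) →
    (∀ x y → M (inj₁ x) (inj₂ y) ≈ 0#) → (∀ y x → M (inj₂ y) (inj₁ x) ≈ 0#) →
    ∀ rs cs → minor M rs cs ≈
      ε ^ crossings rs * (ε ^ crossings cs *
        (minor (λ x x′ → M (inj₁ x) (inj₁ x′)) (lefts rs) (lefts cs) *
         minor (λ y y′ → M (inj₂ y) (inj₂ y′)) (rights rs) (rights cs)))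
  minor-blocks {X} {Y} {X′} {Y′} M M₁₂ M₂₁ = go
    where
    M₁ : X → X′ → Carrier
    M₁ x x′ = M (inj₁ x) (inj₁ x′)
    M₂ : Y → Y′ → Carrier
    M₂ y y′ = M (inj₂ y) (inj₂ y′)

    -- `expand-rights` counts left columns, whereas `crossings` of the rows counts left rows. The
    -- counts agree if the left block is square; otherwise its minor vanishes.
    parity : ∀ xs xs′ → ε ^ length xs′ * minor M₁ xs xs′ ≈ ε ^ length xs * minor M₁ xs xs′
    parity xs xs′ with length xs ℕ.≟ length xs′
    ... | yes eq = *-congʳ (^-congʳ ε (≡.sym eq))
    ... | no neq = trans (trans (*-congˡ 0≈) (zeroʳ _)) (sym (trans (*-congˡ 0≈) (zeroʳ _)))
      where 0≈ = minor-nonsquare M₁ xs xs′ neq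

    go : ∀ rs cs → minor M rs cs ≈
      ε ^ crossings rs * (ε ^ crossings cs * (minor M₁ (lefts rs) (lefts cs) * minor M₂ (rights rs) (rights cs)))
    go [] []            = sym (trans (*-identityˡ _) (trans (*-identityˡ _) (*-identityˡ _)))
    go [] (inj₁ _ ∷ cs) = sym (trans (*-identityˡ _) (trans (*-congˡ (zeroˡ _)) (zeroʳ _)))
    go [] (inj₂ y ∷ cs) = sym (trans (*-identityˡ _) (trans (*-congˡ (zeroʳ _)) (zeroʳ _)))
    go (inj₁ x ∷ rs) cs = begin
      expand (λ c cs′ → M (inj₁ x) c * minor M rs cs′) cs
        ≈⟨ expand-lefts _ (λ d xs ys → (p * minor M₂ (rights rs) ys) * (M₁ x d * minor M₁ (lefts rs) xs))
             (λ y w → trans (*-congʳ (M₁₂ x y)) (zeroˡ _))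
             (λ d w → trans (*-congˡ (go rs w))
               (solve 5 (λ m p q a b → m ⊕ (p ⊕ (q ⊕ (a ⊕ b))) ⊜ q ⊕ ((p ⊕ b) ⊕ (m ⊕ a))) refl
                 (M₁ x d) p (ε ^ crossings w) (minor M₁ (lefts rs) (lefts w)) (minor M₂ (rights rs) (rights w))))
             cs ⟩
      q * expand (λ d xs → (p * m₂) * (M₁ x d * minor M₁ (lefts rs) xs)) (lefts cs)
        ≈⟨ *-congˡ (expand-* (p * m₂) _ (lefts cs)) ⟩
      q * ((p * m₂) * m₁)
        ≈⟨ solve 4 (λ p q a b → q ⊕ ((p ⊕ b) ⊕ a) ⊜ p ⊕ (q ⊕ (a ⊕ b))) refl p q m₁ m₂ ⟩
      p * (q * (m₁ * m₂)) ∎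
      where
      p = ε ^ crossings rs
      q = ε ^ crossings cs
      m₁ = minor M₁ (x ∷ lefts rs) (lefts cs)
      m₂ = minor M₂ (rights rs) (rights cs)
    go (inj₂ y ∷ rs) cs = begin
      expand (λ c cs′ → M (inj₂ y) c * minor M rs cs′) cs
        ≈⟨ expand-rights _ (λ d xs ys → (p * minor M₁ (lefts rs) xs) * (M₂ y d * minor M₂ (rights rs) ys))
             (λ x w → trans (*-congʳ (M₂₁ y x)) (zeroˡ _))
             (λ d w → trans (*-congˡ (go rs w))
               (solve 5 (λ m p q a b → m ⊕ (p ⊕ (q ⊕ (a ⊕ b))) ⊜ q ⊕ ((p ⊕ a) ⊕ (m ⊕ b))) refl
                 (M₂ y d) p (ε ^ crossings w) (minor M₁ (lefts rs) (lefts w)) (minor M₂ (rights rs) (rights w))))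
             cs ⟩
      q * (l′ * expand (λ d ys → (p * m₁) * (M₂ y d * minor M₂ (rights rs) ys)) (rights cs))
        ≈⟨ *-congˡ (*-congˡ (expand-* (p * m₁) _ (rights cs))) ⟩
      q * (l′ * ((p * m₁) * m₂))
        ≈⟨ solve 5 (λ p q l a b → q ⊕ (l ⊕ ((p ⊕ a) ⊕ b)) ⊜ (l ⊕ a) ⊕ (p ⊕ (q ⊕ b))) refl p q l′ m₁ m₂ ⟩
      (l′ * m₁) * (p * (q * m₂))
        ≈⟨ *-congʳ (parity (lefts rs) (lefts cs)) ⟩
      (l * m₁) * (p * (q * m₂))
        ≈⟨ solve 5 (λ p q l a b → (l ⊕ a) ⊕ (p ⊕ (q ⊕ b)) ⊜ (l ⊕ p) ⊕ (q ⊕ (a ⊕ b))) refl p q l m₁ m₂ ⟩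
      (l * p) * (q * (m₁ * m₂))
        ≈⟨ *-congʳ (^-homo-* ε (length (lefts rs)) (crossings rs)) ⟨
      ε ^ (length (lefts rs) ℕ.+ crossings rs) * (q * (m₁ * m₂)) ∎
      where
      p = ε ^ crossings rs
      q = ε ^ crossings cs
      l = ε ^ length (lefts rs)
      l′ = ε ^ length (lefts cs)
      m₁ = minor M₁ (lefts rs) (lefts cs)
      m₂ = minor M₂ (y ∷ rights rs) (rights cs)

  -- Checkerboard matrices

  Checkerboard : ∀ {n} → Matrix n → Set ℓ
  Checkerboard a = ∀ i j → 2 ∣ toℕ i ℕ.+ toℕ j → a i j ≈ 0#

  -- Row and column crossings add up to h². Going from h to h+1 pairs adds 2h+1, and all but one of
  -- these factors `ε` cancel.
  ε^crossings : ∀ {X Y X′ Y′ : Set} {h}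
    (f : Fin h → Y) (g : Fin h → X) (f′ : Fin h → X′) (g′ : Fin h → Y′) →
    ε ^ crossings (interleave (inj₂ ∘ f) (inj₁ ∘ g)) * ε ^ crossings (interleave (inj₁ ∘ f′) (inj₂ ∘ g′)) ≈ ε ^ h
  ε^crossings {h = zero}  f g f′ g′ = *-identityˡ 1#
  ε^crossings {h = suc h} f g f′ g′ = begin
    ε ^ crossings (interleave (inj₂ ∘ f) (inj₁ ∘ g)) * ε ^ crossings (interleave (inj₁ ∘ f′) (inj₂ ∘ g′))
      ≈⟨ *-cong (trans (^-congʳ ε (crossings-interleave₂₁ f g)) (^-homo-* ε (suc h) _))
                (trans (^-congʳ ε (crossings-interleave₁₂ f′ g′)) (^-homo-* ε h _)) ⟩
    ((ε * e) * r) * (e * s)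
      ≈⟨ solve 4 (λ ε e r s → ((ε ⊕ e) ⊕ r) ⊕ (e ⊕ s) ⊜ ε ⊕ (e ⊕ (e ⊕ (r ⊕ s)))) refl ε e r s ⟩
    ε * (e * (e * (r * s)))
      ≈⟨ *-congˡ (trans (ε^n-cancel h _) (ε^crossings (f ∘ suc) (g ∘ suc) (f′ ∘ suc) (g′ ∘ suc))) ⟩
    ε ^ suc h ∎
    where
    e = ε ^ h
    r = ε ^ crossings (interleave (inj₂ ∘ f ∘ suc) (inj₁ ∘ g ∘ suc))
    s = ε ^ crossings (interleave (inj₁ ∘ f′ ∘ suc) (inj₂ ∘ g′ ∘ suc))

  det[ε]-checkerboard-even : ∀ h (a : Matrix (h ℕ.* 2)) → Checkerboard a →
    det[ε] a ≈ ε ^ h * (det[ε] (λ i j → a (odd {h} i) (even {h} j)) * det[ε] (λ i j → a (even {h} i) (odd {h} j)))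
  det[ε]-checkerboard-even h a chk = begin
    det[ε] a
      ≈⟨ minor-tabulate a id id ⟨
    minor a (allFin _) (allFin _)
      ≡⟨ ≡.cong₂ (minor a) (≡.trans (tabulate-interleave h id) (≡.sym (map-interleave u inj₂ inj₁)))
                           (≡.trans (tabulate-interleave h id) (≡.sym (map-interleave v inj₁ inj₂))) ⟩
    minor a (map u rows) (map v cols)
      ≈⟨ minor-map a u v rows cols ⟩
    minor (λ x y → a (u x) (v y)) rows cols
      ≈⟨ minor-blocks (λ x y → a (u x) (v y))
           (λ i j → chk _ _ (odd+odd i j))
           (λ i j → chk _ _ (even∣ (toℕ i) (toℕ j) (toℕ-even i) (toℕ-even j))) rows cols ⟩
    p * (q * (minor oe (lefts rows) (lefts cols) * minor eo (rights rows) (rights cols)))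
      ≈⟨ *-assoc p q _ ⟨
    (p * q) * (minor oe (lefts rows) (lefts cols) * minor eo (rights rows) (rights cols))
      ≡⟨ ≡.cong ((p * q) *_) (≡.cong₂ _*_
           (≡.cong₂ (minor oe) (lefts-interleave₂₁ id id) (lefts-interleave₁₂ id id))
           (≡.cong₂ (minor eo) (rights-interleave₂₁ id id) (rights-interleave₁₂ id id))) ⟩
    (p * q) * (minor oe (allFin h) (allFin h) * minor eo (allFin h) (allFin h))
      ≈⟨ *-cong (ε^crossings {h = h} id id id id) (*-cong (minor-tabulate oe id id) (minor-tabulate eo id id)) ⟩
    ε ^ h * (det[ε] oe * det[ε] eo) ∎
    where
    -- Left means odd for rows but even for columns, so the off-diagonal blocks are the odd-odd and
    -- even-even ones, which vanish.
    u v : Fin h ⊎ Fin h → Fin (h ℕ.* 2)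
    u = [ odd , even ]
    v = [ even , odd ]
    rows cols : List (Fin h ⊎ Fin h)
    rows = interleave inj₂ inj₁
    cols = interleave inj₁ inj₂
    p = ε ^ crossings rows
    q = ε ^ crossings cols
    oe eo : Matrix h
    oe i j = a (odd i) (even j)
    eo i j = a (even i) (odd j)
    odd+odd : ∀ (i j : Fin h) → 2 ∣ toℕ (odd i) ℕ.+ toℕ (odd j)
    odd+odd i j = ≡.subst₂ (λ m n → 2 ∣ m ℕ.+ n) (≡.sym (toℕ-odd i)) (≡.sym (toℕ-odd j))
      (2∣suc+suc (even∣ (toℕ i) (toℕ j) ≡.refl ≡.refl))

  -- There are h odd but h + 1 even positions, so the diagonal blocks are not square.
  det[ε]-checkerboard-odd : ∀ h (a : Matrix (suc (h ℕ.* 2))) → Checkerboard a → det[ε] a ≈ 0#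
  det[ε]-checkerboard-odd h a chk = begin
    det[ε] a
      ≈⟨ minor-tabulate a id id ⟨
    minor a (allFin _) (allFin _)
      -- Index `zero` is split off; the other `h ℕ.* 2` indices form pairs that begin with an odd
      -- one.
      ≡⟨ ≡.cong₂ (λ rs cs → minor a (zero ∷ rs) (zero ∷ cs))
           (≡.trans (tabulate-interleave h suc) (≡.sym (map-interleave u inj₁ (inj₂ ∘ suc))))
           (≡.trans (tabulate-interleave h suc) (≡.sym (map-interleave v inj₂ (inj₁ ∘ suc)))) ⟩
    minor a (map u rows) (map v cols)
      ≈⟨ minor-map a u v rows cols ⟩
    minor (λ x y → a (u x) (v y)) rows cols
      ≈⟨ minor-blocks (λ x y → a (u x) (v y))
           (λ i j → chk _ _ (2∣suc+suc (even∣ (toℕ i) (toℕ j) (toℕ-even i) (toℕ-even j))))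
           (λ i j → chk _ _ (even∣ (toℕ i) (toℕ j) (toℕ-even⁺ i) (toℕ-even⁺ j))) rows cols ⟩
    _ ≈⟨ *-congˡ (*-congˡ (*-congʳ (minor-nonsquare _ (lefts rows) (lefts cols) λ eq →
           ℕ.1+n≢n (≡.trans (≡.sym length-cols) (≡.trans (≡.sym eq) length-rows))))) ⟩
    _ ≈⟨ *-congˡ (trans (*-congˡ (zeroˡ _)) (zeroʳ _)) ⟩
    _ ≈⟨ zeroʳ _ ⟩
    0# ∎
    where
    u : Fin h ⊎ Fin (suc h) → Fin (suc (h ℕ.* 2))
    u = [ suc ∘ even , even⁺ ]
    v : Fin (suc h) ⊎ Fin h → Fin (suc (h ℕ.* 2))
    v = [ even⁺ , suc ∘ even ]
    rows : List (Fin h ⊎ Fin (suc h))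
    rows = inj₂ zero ∷ interleave inj₁ (inj₂ ∘ suc)
    cols : List (Fin (suc h) ⊎ Fin h)
    cols = inj₁ zero ∷ interleave inj₂ (inj₁ ∘ suc)
    length-rows : length (lefts rows) ≡ h
    length-rows = ≡.trans (≡.cong length (lefts-interleave₁₂ {h = h} id Fin.suc)) (length-tabulate {n = h} id)
    length-cols : length (lefts cols) ≡ suc h
    length-cols = ≡.cong suc (≡.trans (≡.cong length (lefts-interleave₂₁ {h = h} id Fin.suc)) (length-tabulate {n = h} Fin.suc))

  x*x≈x^2 : ∀ x → x * x ≈ x ^ 2
  x*x≈x^2 x = *-congˡ (sym (*-identityʳ x))

  -- Symmetry makes the block `eo` the transpose of `oe`, and the sorting sign cancels against the
  -- factor on the left.
  symmetric-checkerboard : ∀ h (a : Matrix (h ℕ.* 2)) → Symmetric a → Checkerboard a →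
    ε ^ h * det[ε] a ≈ det[ε] (λ i j → a (odd {h} i) (even {h} j)) ^ 2
  symmetric-checkerboard h a sym-a chk = begin
    ε ^ h * det[ε] a
      ≈⟨ *-congˡ (det[ε]-checkerboard-even h a chk) ⟩
    ε ^ h * (ε ^ h * (det[ε] oe * det[ε] eo))
      ≈⟨ ε^n-cancel h _ ⟩
    det[ε] oe * det[ε] eo
      ≈⟨ *-congˡ (trans (det[ε]-cong {h} λ i j → sym-a (even i) (odd j)) (det[ε]-transpose oe)) ⟩
    det[ε] oe * det[ε] oe
      ≈⟨ x*x≈x^2 _ ⟩
    det[ε] oe ^ 2 ∎
    where
    oe eo : Matrix h
    oe i j = a (odd i) (even j)
    eo i j = a (even i) (odd j)

  clearCorner-symmetric : ∀ {n} {a : Matrix (suc n)} → Symmetric a → Symmetric (clearCorner a)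
  clearCorner-symmetric sym-a zero    zero    = refl
  clearCorner-symmetric sym-a zero    (suc j) = sym-a zero (suc j)
  clearCorner-symmetric sym-a (suc i) zero    = sym-a (suc i) zero
  clearCorner-symmetric sym-a (suc i) (suc j) = sym-a (suc i) (suc j)

  -- The corner entry and the two parities of the size

  det[ε]-square-even : ∀ h (a : Matrix (suc h ℕ.* 2)) → Symmetric a → Checkerboard (clearCorner a) →
    ε ^ suc h * det[ε] a ≈ det[ε] (λ i j → a (odd {suc h} i) (even {suc h} j)) ^ 2
  det[ε]-square-even h a sym-a chk = begin
    ε ^ suc h * det[ε] a
      ≈⟨ *-congˡ (det[ε]-corner a) ⟩
    ε ^ suc h * (a zero zero * det[ε] (λ i j → a (suc i) (suc j)) + det[ε] (clearCorner a))
      -- Deleting the first row and column changes index sums by two, so the minor is a checkerboard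
      -- matrix of odd size and vanishes.
      ≈⟨ *-congˡ (trans (+-congʳ (trans (*-congˡ (det[ε]-checkerboard-odd h _
           λ i j → chk (suc i) (suc j) ∘ 2∣suc+suc)) (zeroʳ _))) (+-identityˡ _)) ⟩
    ε ^ suc h * det[ε] (clearCorner a)
      ≈⟨ symmetric-checkerboard (suc h) (clearCorner a) (clearCorner-symmetric sym-a) chk ⟩
    det[ε] (λ i j → clearCorner a (odd {suc h} i) (even {suc h} j)) ^ 2
      -- The rows of this block are `odd`, so it avoids the cleared corner.
      ≈⟨ ^-congˡ 2 (det[ε]-cong {a = λ i j → clearCorner a (odd {suc h} i) (even {suc h} j)}
           {b = λ i j → a (odd {suc h} i) (even {suc h} j)} λ { zero j → refl ; (suc i) j → refl }) ⟩
    det[ε] (λ i j → a (odd {suc h} i) (even {suc h} j)) ^ 2 ∎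

  det[ε]-square-odd : ∀ h (a : Matrix (suc (h ℕ.* 2))) → Symmetric a → Checkerboard (clearCorner a) →
    ε ^ h * det[ε] a ≈ a zero zero * det[ε] (λ i j → a (suc (even {h} i)) (suc (odd {h} j))) ^ 2
  det[ε]-square-odd h a sym-a chk = begin
    ε ^ h * det[ε] a
      ≈⟨ *-congˡ (det[ε]-corner a) ⟩
    ε ^ h * (a zero zero * det[ε] b + det[ε] (clearCorner a))
      ≈⟨ *-congˡ (trans (+-congˡ (det[ε]-checkerboard-odd h _ chk)) (+-identityʳ _)) ⟩
    ε ^ h * (a zero zero * det[ε] b)
      ≈⟨ x∙yz≈y∙xz _ _ _ ⟩
    a zero zero * (ε ^ h * det[ε] b)
      ≈⟨ *-congˡ (symmetric-checkerboard h b (λ i j → sym-a (suc i) (suc j))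
           (λ i j → chk (suc i) (suc j) ∘ 2∣suc+suc)) ⟩
    a zero zero * det[ε] oe ^ 2
      -- A second use of symmetry passes to the transposed block, whose rows are the even one-based
      -- positions of `a`.
      ≈⟨ *-congˡ (^-congˡ 2 (trans (det[ε]-cong {h} λ i j → sym-a (suc (odd i)) (suc (even j))) (det[ε]-transpose eo))) ⟩
    a zero zero * det[ε] eo ^ 2 ∎
    where
    b : Matrix (h ℕ.* 2)
    b i j = a (suc i) (suc j)
    oe eo : Matrix h
    oe i j = b (odd i) (even j)
    eo i j = b (even i) (odd j)

  VanishesOnEvenSums : ∀ {n} → Matrix n → Set ℓ
  VanishesOnEvenSums a = ∀ i j → (∃ λ q → 2 ≤ q × pos i ℕ.+ pos j ≡ 2 ℕ.* q) → a i j ≈ 0#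

  -- One-based sums exceed zero-based ones by two. The bound `2 ≤ q` leaves out only the corner,
  -- which has been cleared.
  clearCorner-checkerboard : ∀ {n} (a : Matrix (suc n)) → VanishesOnEvenSums a → Checkerboard (clearCorner a)
  clearCorner-checkerboard a van = go
    where
    vanish : ∀ i j {k} → toℕ i ℕ.+ toℕ j ≡ suc k ℕ.* 2 → a i j ≈ 0#
    -- A zero-based sum 2(k+1) is a one-based sum 2(k+2), so q is k+2.
    vanish i j {k} eq = van i j (suc (suc k) , s≤s (s≤s z≤n) ,
      ≡.trans (≡.cong suc (ℕ.+-suc (toℕ i) (toℕ j)))
              (≡.trans (≡.cong (2 ℕ.+_) eq) (ℕ.*-comm (suc (suc k)) 2)))
    go : Checkerboard (clearCorner a)
    go zero    zero    _                    = refl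
    go zero    (suc j) (divides (suc k) eq) = vanish zero (suc j) {k} eq
    go (suc i) j       (divides (suc k) eq) = vanish (suc i) j {k} eq

  -- The size enters through an equation, so that matching on it turns `n` into `h ℕ.* 2`; it is
  -- applied with `h` equal to `n / 2`.
  square-even : ∀ {n h} → h ℕ.* 2 ≡ n → 1 ≤ n → .(2h≤n : 2 ℕ.* h ≤ n) (a : Matrix n) →
    Symmetric a → VanishesOnEvenSums a →
    ε ^ h * det[ε] a ≈ det[ε] (λ i j → a (at-2i {h} 2h≤n i) (at-2i-1 {h} 2h≤n j)) ^ 2
  square-even {h = suc h} ≡.refl 1≤n 2h≤n a sym-a van = trans
    (det[ε]-square-even h a sym-a (clearCorner-checkerboard a van))
    (^-congˡ 2 (det[ε]-cong λ i j → reflexive (≡.sym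
      (≡.cong₂ a (at-2i≡odd {suc h} 2h≤n i) (at-2i-1≡even {suc h} 2h≤n j)))))

  square-odd : ∀ {n h} → h ℕ.* 2 ≡ n → .(2h≤n : 2 ℕ.* h ≤ suc n) .(2h<n : 2 ℕ.* h < suc n) (a : Matrix (suc n)) →
    Symmetric a → VanishesOnEvenSums a →
    ε ^ h * det[ε] a ≈
      a zero zero * det[ε] (λ i j → a (at-2i {h} 2h≤n i) (at-2i+1 {h} 2h<n j)) ^ 2
  square-odd {h = h} ≡.refl 2h≤n 2h<n a sym-a van = trans
    (det[ε]-square-odd h a sym-a (clearCorner-checkerboard a van))
    (*-congˡ (^-congˡ 2 (det[ε]-cong λ i j → reflexive (≡.sym
      (≡.cong₂ a (at-2i≡suc-even {h} 2h≤n i) (at-2i+1≡suc-odd {h} 2h<n j))))))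

-- Specialisation to permanent and determinant

module _ {c ℓ} (R : CommutativeRing c ℓ) where
  open CommutativeRing R hiding (zero)
  open Matrices R
  open Determinants R 1# using (∑List-cong) renaming (det[ε] to det[1])
  open RingProperties ring using (-1*x≈-x; -‿involutive)

  1^n*x≈x : ∀ n x → 1# ^ n * x ≈ x
  1^n*x≈x zero    x = *-identityˡ x
  1^n*x≈x (suc n) x = trans (*-congʳ (*-identityˡ _)) (1^n*x≈x n x)

  det[1]≈per : ∀ {n} (a : Matrix n) → det[1] a ≈ per a
  det[1]≈per {n} a = ∑List-cong (λ σ → 1^n*x≈x (inversions σ) _) (permutations n)

  -1*-1≈1 : - 1# * - 1# ≈ 1#
  -1*-1≈1 = trans (-1*x≈-x (- 1#)) (-‿involutive 1#)

corollary1p2 :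
  ∀ {c ℓ} (R : CommutativeRing c ℓ) →
  let open CommutativeRing R
      open Matrices R
  in
  (n : ℕ) (1≤n : 1 ≤ n) (a : Matrix n) →
  Symmetric a →
  (∀ i j → (∃ λ q → 2 ≤ q × pos i ℕ.+ pos j ≡ 2 ℕ.* q) → a i j ≈ 0#) →
  (2 ∣ n →
    let 2i   = at-2i   {h = n / 2} (2*[n/2]≤n n)
        2j-1 = at-2i-1 {h = n / 2} (2*[n/2]≤n n)
    in
    (per a ≈ per (λ i j → a (2i i) (2j-1 j)) ^ 2)
    × ((- 1#) ^ (n / 2) * det a ≈ det (λ i j → a (2i i) (2j-1 j)) ^ 2))
  ×
  (1 < n → 2 ∤ n →
    let a₁₁  = a (at 1 ≤-refl 1≤n) (at 1 ≤-refl 1≤n)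
        2i   = at-2i   {h = (n ∸ 1) / 2} (<⇒≤ (2*[[n∸1]/2]<n 1≤n))
        2j+1 = at-2i+1 {h = (n ∸ 1) / 2} (2*[[n∸1]/2]<n 1≤n)
    in
    (per a ≈ a₁₁ * per (λ i j → a (2i i) (2j+1 j)) ^ 2)
    × ((- 1#) ^ ((n ∸ 1) / 2) * det a ≈ a₁₁ * det (λ i j → a (2i i) (2j+1 j)) ^ 2))
-- Matching `n` as `suc m` reduces `n ∸ 1` to `m` and the corner index to `zero`.
corollary1p2 R n@(suc m) 1≤n a sym-a van =
  (λ 2∣n → let n/2*2≡n = m/n*n≡m 2∣n
               2h≤n    = 2*[n/2]≤n n
               b       = λ i j → a (at-2i {n / 2} 2h≤n i) (at-2i-1 {n / 2} 2h≤n j)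
           in
    per-form (n / 2) (P.square-even {h = n / 2} n/2*2≡n 1≤n 2h≤n a sym-a van)
             (^-congˡ 2 (det[1]≈per R b)) ,
    D.square-even {h = n / 2} n/2*2≡n 1≤n 2h≤n a sym-a van) ,
  (λ _ 2∤n → let m/2*2≡m = m/n*n≡m (2∣pred 2∤n)
                 2h<n    = 2*[[n∸1]/2]<n 1≤n
                 b       = λ i j → a (at-2i {m / 2} (<⇒≤ 2h<n) i) (at-2i+1 {m / 2} 2h<n j)
             in
    per-form (m / 2) (P.square-odd {h = m / 2} m/2*2≡m (<⇒≤ 2h<n) 2h<n a sym-a van)
             (*-congˡ (^-congˡ 2 (det[1]≈per R b))) ,
    D.square-odd {h = m / 2} m/2*2≡m (<⇒≤ 2h<n) 2h<n a sym-a van)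
  where
  open CommutativeRing R hiding (zero)
  open Matrices R
  open import Algebra.Properties.Semiring.Exp semiring using (^-congˡ)
  module P = Signed R 1# (*-identityˡ 1#)
  -- At `- 1#` the sum `det[ε]` unfolds to `det`, so these instances give the determinant formulas
  -- directly.
  module D = Signed R (- 1#) (-1*-1≈1 R)
  per-form : ∀ h {x y} → 1# ^ h * Determinants.det[ε] R 1# a ≈ x → x ≈ y → per a ≈ y
  per-form h eq x≈y = trans (sym (det[1]≈per R a)) (trans (sym (1^n*x≈x R h _)) (trans eq x≈y))
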